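{- There exists a deterministic algorithm that finds the sink of any $n$-dimensional Matoušek-type USO using at most $n$ vertex evaluations.
   Context: All vectors and matrices are over $GF(2)$; $\oplus$ denotes xor. An orientation of the hypercube $\{0,1\}^n$ is given by an outmap $o:\{0,1\}^n\to\{0,1\}^n$, the edge $\{v,v\oplus e_i\}$ being directed away from $v$ iff $o(v)_i=1$. An $n$-dimensional Matoušek-type USO is an orientation $o(v)=M(v\oplus s)$ with $M=PAP^T$ for a permutation matrix $P$ and an invertible upper-triangular $A\in\{0,1\}^{n\times n}$, and $s\in\{0,1\}^n$, the unique sink ($o(s)=0$). A sink-finding algorithm queries vertices $v$ and receives $o(v)$; it succeeds when it can output $s$. -}

module Defs where

open import Algebra.Bundles using (CommutativeRing)
open import Data.Bool.Base using (Bool; false; _∧_; _xor_)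
open import Data.Bool.Properties using (xor-∧-commutativeRing)
open import Data.Fin.Base using (Fin; _<_)
open import Data.Fin.Permutation using (Permutation′; _⟨$⟩ʳ_)
open import Data.Fin.Properties using (_≟_)
open import Data.Nat.Base using (ℕ; zero; suc)
open import Data.Product.Base using (Σ-syntax; ∃-syntax; _×_)
open import Data.Vec.Base using (Vec; lookup; replicate; tabulate; zipWith)
open import Relation.Binary.PropositionalEquality.Core using (_≡_)
open import Relation.Nullary.Decidable.Core using (does)

-- GF(2) is Bool with _xor_ and _∧_; sums below are iterated xor.
open import Algebra.Properties.Semiring.Sum
  (CommutativeRing.semiring xor-∧-commutativeRing) using (sum)

private
  variable
    n : ℕ

infixl 6 _⊕_
infixl 7 _⊗_
infixr 7 _·_
infix  8 _ᵀ

Vertex : ℕ → Set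
Vertex n = Vec Bool n

_⊕_ : Vertex n → Vertex n → Vertex n
_⊕_ = zipWith _xor_

Matrix : ℕ → Set
Matrix n = Fin n → Fin n → Bool

_·_ : Matrix n → Vertex n → Vertex n
M · v = tabulate λ i → sum λ j → M i j ∧ lookup v j

_⊗_ : Matrix n → Matrix n → Matrix n
(M ⊗ N) i k = sum λ j → M i j ∧ N j k

_ᵀ : Matrix n → Matrix n
(M ᵀ) i j = M j i

identity : Matrix n
identity i j = does (i ≟ j)

infix 4 _≈_

_≈_ : Matrix n → Matrix n → Set
M ≈ N = ∀ i j → M i j ≡ N i j

IsInvertible : Matrix n → Set
IsInvertible M = ∃[ N ] (M ⊗ N ≈ identity × N ⊗ M ≈ identity)

IsUpperTriangular : Matrix n → Set
IsUpperTriangular M = ∀ i j → j < i → M i j ≡ false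

IsPermutationMatrix : Matrix n → Set
IsPermutationMatrix {n} P =
  Σ[ π ∈ Permutation′ n ] (∀ i j → P i j ≡ does ((π ⟨$⟩ʳ i) ≟ j))

-- The hypercube edge between v and v ⊕ eᵢ is directed away from v
-- iff lookup (o v) i ≡ true.
Outmap : ℕ → Set
Outmap n = Vertex n → Vertex n

IsSink : Outmap n → Vertex n → Set
IsSink {n} o v = o v ≡ replicate n false

IsUniqueSink : Outmap n → Vertex n → Set
IsUniqueSink o v = IsSink o v × (∀ u → IsSink o u → u ≡ v)

-- Over GF(2), an invertible upper-triangular A has an all-ones diagonal,
-- hence so does M.  Therefore lookup (o v) i and lookup (o (v ⊕ eᵢ)) i
-- always differ: the two endpoints agree on the direction of their edge,
-- and consistency of the orientation need not be required separately.
-- The sink is s, since M · (v ⊕ s) vanishes only for v = s.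
record IsMatousekTypeUSO (o : Outmap n) : Set where
  field
    P                 : Matrix n
    A                 : Matrix n
    s                 : Vertex n
    P-isPermutation   : IsPermutationMatrix P
    A-isInvertible    : IsInvertible A
    A-upperTriangular : IsUpperTriangular A

  M : Matrix n
  M = P ⊗ A ⊗ P ᵀ

  field
    outmap : ∀ v → o v ≡ M · (v ⊕ s)

-- A deterministic sink-finding algorithm in dimension n: a decision tree
-- whose next step depends only on the answers received so far.  It need
-- not evaluate the vertex that it finally outputs.
data Algorithm (n : ℕ) : Set where
  output : (t : Vertex n) → Algorithm n
  query  : (v : Vertex n) (next : Vertex n → Algorithm n) → Algorithm n

result : Algorithm n → Outmap n → Vertex n
result (output t)     o = t
result (query v next) o = result (next (o v)) o

evaluations : Algorithm n → Outmap n → ℕ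
evaluations (output t)     o = zero
evaluations (query v next) o = suc (evaluations (next (o v)) o)

-- Start anywhere and repeatedly jump from v to v ⊕ o(v).  Since o is affine
-- with linear part M, a jump replaces the outmap value w by w ⊕ M w.  In the
-- coordinate order given by the permutation, I ⊕ M is strictly upper
-- triangular, so each jump kills one more trailing coordinate of w, and after
-- n jumps the outmap value is 0.  The last vertex need not be evaluated.
-- Nilpotency of I ⊕ M also gives uniqueness: M w = 0 makes w a fixed point
-- of I ⊕ M, so w = 0.
{-# OPTIONS --safe #-}
module Submission where

open import Defs
open import Algebra.Bundles using (CommutativeRing)
open import Data.Bool.Base using (Bool; true; false; _∧_; _xor_)
open import Data.Bool.Properties
  using (xor-∧-commutativeRing; xor-same; xor-assoc; xor-comm; xor-identityʳ;
         ∧-zeroʳ; ∧-identityʳ; ∧-distribˡ-xor)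
open import Data.Fin.Base as Fin using (Fin; toℕ)
open import Data.Fin.Induction using (<-wellFounded)
open import Data.Fin.Permutation using (Permutation′; _⟨$⟩ʳ_)
open import Data.Fin.Properties using (_≟_; <-cmp; <⇒≢; <-trans; punchInᵢ≢i; toℕ<n)
open import Data.Nat.Base using (ℕ; zero; suc; _≤_; z≤n)
open import Data.Nat.Properties using (≤-reflexive; ≤-<-trans; <⇒≱)
open import Data.Product.Base using (Σ-syntax; _×_; _,_; proj₁; proj₂)
open import Data.Vec.Base using (lookup; replicate)
open import Data.Vec.Properties
  using (lookup∘tabulate; lookup-zipWith; lookup-replicate; tabulate∘lookup;
         tabulate-cong; zipWith-assoc; zipWith-comm; zipWith-identityʳ)
open import Function.Base using (_∘_)
open import Function.Bundles using (Injection)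
open import Function.Definitions using (Injective)
open import Function.Properties.Inverse using (↔⇒↣)
open import Induction.WellFounded using (Acc; acc)
open import Relation.Binary.Definitions using (tri<; tri≈; tri>)
open import Relation.Binary.PropositionalEquality
open import Relation.Nullary.Decidable using (does; dec-true; dec-false)
open import Relation.Nullary.Negation using (contradiction)

open import Algebra.Properties.Semiring.Sum
  (CommutativeRing.semiring xor-∧-commutativeRing)
  using (sum; sum-cong-≗; sum-remove; sum-replicate-zero; ∑-distrib-+)

open ≡-Reasoning

private
  variable
    n : ℕ

sum-single : ∀ (f : Fin n → Bool) i → (∀ j → j ≢ i → f j ≡ false) →
             sum f ≡ f i
sum-single {suc n} f i f≡0 = begin
  sum f
    ≡⟨ sum-remove {i = i} f ⟩
  f i xor sum (λ j → f (Fin.punchIn i j))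
    ≡⟨ cong (f i xor_) (sum-cong-≗ λ j → f≡0 _ (punchInᵢ≢i i j)) ⟩
  f i xor sum {n} (λ _ → false)
    ≡⟨ cong (f i xor_) (sum-replicate-zero n) ⟩
  f i xor false
    ≡⟨ xor-identityʳ (f i) ⟩
  f i ∎

xor≡false⇒≡ : ∀ x y → x xor y ≡ false → x ≡ y
xor≡false⇒≡ false false _ = refl
xor≡false⇒≡ true  true  _ = refl

lookup-ext : ∀ {v w : Vertex n} → (∀ i → lookup v i ≡ lookup w i) → v ≡ w
lookup-ext {v = v} {w} eq =
  trans (sym (tabulate∘lookup v)) (trans (tabulate-cong eq) (tabulate∘lookup w))

⊕≡0⇒≡ : ∀ (v w : Vertex n) → v ⊕ w ≡ replicate n false → v ≡ w
⊕≡0⇒≡ {n} v w eq = lookup-ext λ i → xor≡false⇒≡ _ _ (begin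
  lookup v i xor lookup w i      ≡⟨ lookup-zipWith _xor_ i v w ⟨
  lookup (v ⊕ w) i               ≡⟨ cong (λ u → lookup u i) eq ⟩
  lookup (replicate n false) i   ≡⟨ lookup-replicate i false ⟩
  false                          ∎)

⊕-swapʳ : ∀ (u v w : Vertex n) → (u ⊕ v) ⊕ w ≡ (u ⊕ w) ⊕ v
⊕-swapʳ u v w = begin
  (u ⊕ v) ⊕ w   ≡⟨ zipWith-assoc xor-assoc u v w ⟩
  u ⊕ (v ⊕ w)   ≡⟨ cong (u ⊕_) (zipWith-comm xor-comm v w) ⟩
  u ⊕ (w ⊕ v)   ≡⟨ zipWith-assoc xor-assoc u w v ⟨
  (u ⊕ w) ⊕ v   ∎

·-distribˡ-⊕ : ∀ (M : Matrix n) v w → M · (v ⊕ w) ≡ M · v ⊕ M · w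
·-distribˡ-⊕ M v w = lookup-ext λ i → begin
  lookup (M · (v ⊕ w)) i
    ≡⟨ lookup∘tabulate _ i ⟩
  sum (λ j → M i j ∧ lookup (v ⊕ w) j)
    ≡⟨ sum-cong-≗ (λ j → trans (cong (M i j ∧_) (lookup-zipWith _xor_ j v w))
                               (∧-distribˡ-xor (M i j) _ _)) ⟩
  sum (λ j → (M i j ∧ lookup v j) xor (M i j ∧ lookup w j))
    ≡⟨ ∑-distrib-+ (λ j → M i j ∧ lookup v j) (λ j → M i j ∧ lookup w j) ⟩
  sum (λ j → M i j ∧ lookup v j) xor sum (λ j → M i j ∧ lookup w j)
    ≡⟨ cong₂ _xor_ (lookup∘tabulate _ i) (lookup∘tabulate _ i) ⟨
  lookup (M · v) i xor lookup (M · w) i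
    ≡⟨ lookup-zipWith _xor_ i (M · v) (M · w) ⟨
  lookup (M · v ⊕ M · w) i ∎

-- Row `i` of `P` has its only one in column `π ⟨$⟩ʳ i`, so each of the two sums collapses to a
-- single term. Rows and columns are relabelled alike, so diagonal entries stay on the diagonal.
conjugate-entry : ∀ {P : Matrix n} (π : Permutation′ n) (A : Matrix n) →
  (∀ i j → P i j ≡ does ((π ⟨$⟩ʳ i) ≟ j)) →
  ∀ i j → (P ⊗ A ⊗ P ᵀ) i j ≡ A (π ⟨$⟩ʳ i) (π ⟨$⟩ʳ j)
conjugate-entry {P = P} π A P≡π i j = begin
  sum (λ l → (P ⊗ A) i l ∧ P j l)
    ≡⟨ sum-single _ (π ⟨$⟩ʳ j) (λ l l≢ →
         trans (cong ((P ⊗ A) i l ∧_) (P-off j (l≢ ∘ sym))) (∧-zeroʳ _)) ⟩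
  (P ⊗ A) i (π ⟨$⟩ʳ j) ∧ P j (π ⟨$⟩ʳ j)
    ≡⟨ trans (cong ((P ⊗ A) i (π ⟨$⟩ʳ j) ∧_) (P-on j)) (∧-identityʳ _) ⟩
  sum (λ k → P i k ∧ A k (π ⟨$⟩ʳ j))
    ≡⟨ sum-single _ (π ⟨$⟩ʳ i) (λ k k≢ →
         cong (_∧ A k (π ⟨$⟩ʳ j)) (P-off i (k≢ ∘ sym))) ⟩
  P i (π ⟨$⟩ʳ i) ∧ A (π ⟨$⟩ʳ i) (π ⟨$⟩ʳ j)
    ≡⟨ cong (_∧ A (π ⟨$⟩ʳ i) (π ⟨$⟩ʳ j)) (P-on i) ⟩
  A (π ⟨$⟩ʳ i) (π ⟨$⟩ʳ j) ∎
  where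
  P-on : ∀ i → P i (π ⟨$⟩ʳ i) ≡ true
  P-on i = trans (P≡π i _) (dec-true ((π ⟨$⟩ʳ i) ≟ (π ⟨$⟩ʳ i)) refl)

  P-off : ∀ i {k} → (π ⟨$⟩ʳ i) ≢ k → P i k ≡ false
  P-off i ≢k = trans (P≡π i _) (dec-false (_ ≟ _) ≢k)

-- A left inverse N of A is itself upper triangular; this is shown column by
-- column, each column of N ⊗ A = I also yielding one diagonal entry of A.
module _ {A N : Matrix n} (A-upper : IsUpperTriangular A)
         (NA≈I : N ⊗ A ≈ identity) where

  private
    -- Terms with `k < j` vanish through `N`, those with `k > j` through the triangularity of `A`.
    product-entry : ∀ {i j} → (∀ k → k Fin.< j → N i k ≡ false) →
                    (N ⊗ A) i j ≡ N i j ∧ A j j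
    product-entry {i} {j} Nik≡0 = sum-single _ j off
      where
      off : ∀ k → k ≢ j → N i k ∧ A k j ≡ false
      off k k≢j with <-cmp k j
      ... | tri< k<j _ _ = cong (_∧ A k j) (Nik≡0 k k<j)
      ... | tri≈ _ k≡j _ = contradiction k≡j k≢j
      ... | tri> _ _ j<k = trans (cong (N i k ∧_) (A-upper k j j<k)) (∧-zeroʳ _)

    -- Both claims go through one induction: zeros of `N` in earlier columns isolate the term
    -- `N i j ∧ A j j`; `i = j` then forces `A j j` to be one, and with that known `i > j` forces
    -- `N i j` to be zero.
    column : ∀ j → Acc Fin._<_ j →
             A j j ≡ true × (∀ i → j Fin.< i → N i j ≡ false)
    column j (acc rec) = Ajj≡1 , below
      where
      left : ∀ {i} k → k Fin.< j → k Fin.< i → N i k ≡ false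
      left {i} k k<j k<i = proj₂ (column k (rec k<j)) i k<i

      ∧≡true⇒ʳ : ∀ x y → x ∧ y ≡ true → y ≡ true
      ∧≡true⇒ʳ true y eq = eq

      Ajj≡1 : A j j ≡ true
      Ajj≡1 = ∧≡true⇒ʳ (N j j) (A j j) (begin
        N j j ∧ A j j   ≡⟨ product-entry (λ k k<j → left k k<j k<j) ⟨
        (N ⊗ A) j j     ≡⟨ NA≈I j j ⟩
        identity j j    ≡⟨ dec-true (j ≟ j) refl ⟩
        true            ∎)

      below : ∀ i → j Fin.< i → N i j ≡ false
      below i j<i = begin
        N i j           ≡⟨ ∧-identityʳ _ ⟨
        N i j ∧ true    ≡⟨ cong (N i j ∧_) Ajj≡1 ⟨
        N i j ∧ A j j   ≡⟨ product-entry (λ k k<j → left k k<j (<-trans k<j j<i)) ⟨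
        (N ⊗ A) i j     ≡⟨ NA≈I i j ⟩
        identity i j    ≡⟨ dec-false (i ≟ j) (<⇒≢ j<i ∘ sym) ⟩
        false           ∎

  upperTriangular∧leftInverse⇒unitDiagonal : ∀ j → A j j ≡ true
  upperTriangular∧leftInverse⇒unitDiagonal j = proj₁ (column j (<-wellFounded j))

-- There is no test for having reached the sink: a jump from there stands still, so the number of
-- queries can be fixed in advance.
antipodalJumps : ℕ → Vertex n → Algorithm n
antipodalJumps zero    v = output v
antipodalJumps (suc k) v = query v λ w → antipodalJumps k (v ⊕ w)

antipodalJumps-evaluations : ∀ k (v : Vertex n) o →
                             evaluations (antipodalJumps k v) o ≡ k
antipodalJumps-evaluations zero    v o = refl
antipodalJumps-evaluations (suc k) v o =
  cong suc (antipodalJumps-evaluations k (v ⊕ o v) o)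

module _ {M : Matrix n} (ρ : Fin n → Fin n) (ρ-injective : Injective _≡_ _≡_ ρ)
         (M-diagonal : ∀ i → M i i ≡ true)
         (M-upper : ∀ i j → ρ j Fin.< ρ i → M i j ≡ false) where

  -- `ρ i` is the rank of coordinate `i` in the order that makes `M` triangular. The threshold is a
  -- natural number so that it can run from `n`, where nothing is claimed, down to `0`, where the
  -- whole vector is zero.
  VanishesFrom : ℕ → Vertex n → Set
  VanishesFrom k w = ∀ i → k ≤ toℕ (ρ i) → lookup w i ≡ false

  vanishesFrom-n : ∀ w → VanishesFrom n w
  vanishesFrom-n w i n≤ρi = contradiction n≤ρi (<⇒≱ (toℕ<n (ρ i)))

  vanishesFrom-0 : ∀ {w} → VanishesFrom 0 w → w ≡ replicate n false
  vanishesFrom-0 w≡0 =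
    lookup-ext λ i → trans (w≡0 i z≤n) (sym (lookup-replicate i false))

  -- In a row of rank at least `k`, lower ranks are killed by `M` and higher ranks by `w`. Only the
  -- diagonal term `lookup w i` is left, and it cancels against the summand from `w`.
  jump-vanishes : ∀ {k} w → VanishesFrom (suc k) w → VanishesFrom k (w ⊕ M · w)
  jump-vanishes {k} w w≡0 i k≤ρi = begin
    lookup (w ⊕ M · w) i
      ≡⟨ lookup-zipWith _xor_ i w (M · w) ⟩
    lookup w i xor lookup (M · w) i
      ≡⟨ cong (lookup w i xor_) (lookup∘tabulate _ i) ⟩
    lookup w i xor sum (λ j → M i j ∧ lookup w j)
      ≡⟨ cong (lookup w i xor_) (sum-single _ i off) ⟩
    lookup w i xor (M i i ∧ lookup w i)
      ≡⟨ cong (λ m → lookup w i xor (m ∧ lookup w i)) (M-diagonal i) ⟩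
    lookup w i xor lookup w i
      ≡⟨ xor-same (lookup w i) ⟩
    false ∎
    where
    off : ∀ j → j ≢ i → M i j ∧ lookup w j ≡ false
    off j j≢i with <-cmp (ρ j) (ρ i)
    ... | tri< ρj<ρi _ _ = cong (_∧ lookup w j) (M-upper i j ρj<ρi)
    ... | tri≈ _ ρj≡ρi _ = contradiction (ρ-injective ρj≡ρi) j≢i
    -- The strict inequality supplies the extra one: the rank of `j` is at least `suc k`.
    ... | tri> _ _ ρi<ρj =
      trans (cong (M i j ∧_) (w≡0 j (≤-<-trans k≤ρi ρi<ρj))) (∧-zeroʳ _)

  kernel-trivial : ∀ {w} → M · w ≡ replicate n false → w ≡ replicate n false
  kernel-trivial {w} Mw≡0 = vanishesFrom-0 (descend n (vanishesFrom-n w))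
    where
    fixed : w ⊕ M · w ≡ w
    fixed = trans (cong (w ⊕_) Mw≡0) (zipWith-identityʳ xor-identityʳ w)

    -- The vector stays the same while the threshold drops.
    descend : ∀ k → VanishesFrom k w → VanishesFrom 0 w
    descend zero    w≡0 = w≡0
    descend (suc k) w≡0 =
      descend k (subst (VanishesFrom k) fixed (jump-vanishes w w≡0))

  module _ {o : Outmap n} {s : Vertex n} (o≡ : ∀ v → o v ≡ M · (v ⊕ s)) where

    -- The unknown `s` is absorbed into `o v`, so outmap values evolve by `M` alone.
    outmap-jump : ∀ v → o (v ⊕ o v) ≡ o v ⊕ M · o v
    outmap-jump v = begin
      o (v ⊕ o v)               ≡⟨ o≡ (v ⊕ o v) ⟩
      M · (v ⊕ o v ⊕ s)         ≡⟨ cong (M ·_) (⊕-swapʳ v (o v) s) ⟩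
      M · (v ⊕ s ⊕ o v)         ≡⟨ ·-distribˡ-⊕ M (v ⊕ s) (o v) ⟩
      M · (v ⊕ s) ⊕ M · o v     ≡⟨ cong (_⊕ M · o v) (o≡ v) ⟨
      o v ⊕ M · o v             ∎

    -- The invariant ties the number of queries left to the threshold of the current outmap value;
    -- each jump lowers both by one.
    antipodalJumps-sink : ∀ k v → VanishesFrom k (o v) →
                          IsSink o (result (antipodalJumps k v) o)
    antipodalJumps-sink zero    v ov≡0 = vanishesFrom-0 ov≡0
    antipodalJumps-sink (suc k) v ov≡0 = antipodalJumps-sink k (v ⊕ o v)
      (subst (VanishesFrom k) (sym (outmap-jump v)) (jump-vanishes (o v) ov≡0))

    sink≡s : ∀ u → IsSink o u → u ≡ s
    sink≡s u ou≡0 = ⊕≡0⇒≡ u s (kernel-trivial (trans (sym (o≡ u)) ou≡0))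

    antipodalJumps-uniqueSink : ∀ v → IsUniqueSink o (result (antipodalJumps n v) o)
    antipodalJumps-uniqueSink v =
      sink , λ u u-sink → trans (sink≡s u u-sink) (sym (sink≡s _ sink))
      where
      sink : IsSink o (result (antipodalJumps n v) o)
      sink = antipodalJumps-sink n v (vanishesFrom-n (o v))

theorem18 : Σ[ algorithm ∈ ((n : ℕ) → Algorithm n) ]
    (∀ (n : ℕ) (o : Outmap n) → IsMatousekTypeUSO o →
    IsUniqueSink o (result (algorithm n) o) ×
    evaluations (algorithm n) o ≤ n)
theorem18 = (λ n → antipodalJumps n (origin n)) , λ n o uso →
  uniqueSink o uso , ≤-reflexive (antipodalJumps-evaluations n (origin n) o)
  where
  origin : ∀ n → Vertex n
  origin n = replicate n false

  uniqueSink : ∀ {n} o → IsMatousekTypeUSO o →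
               IsUniqueSink o (result (antipodalJumps n (origin n)) o)
  uniqueSink {n} o uso with IsMatousekTypeUSO.P-isPermutation uso
                          | IsMatousekTypeUSO.A-isInvertible uso
  ... | π , P≡π | _ , _ , NA≈I =
    -- Ranking coordinates by `π` carries the unit diagonal and triangularity of `A` over to `M`.
    antipodalJumps-uniqueSink (π ⟨$⟩ʳ_) (Injection.injective (↔⇒↣ π))
      (λ i → trans (M≡ i i) (upperTriangular∧leftInverse⇒unitDiagonal
                              A-upperTriangular NA≈I (π ⟨$⟩ʳ i)))
      (λ i j πj<πi → trans (M≡ i j) (A-upperTriangular _ _ πj<πi))
      outmap (origin n)
    where
    open IsMatousekTypeUSO uso
    M≡ : ∀ i j → M i j ≡ A (π ⟨$⟩ʳ i) (π ⟨$⟩ʳ j)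
    M≡ = conjugate-entry π A P≡π
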